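{- Let $C$ be a cyclically ordered graph that contains $L_3$ and such that every edge of $C$ is a minedge or a bisuperedge. Then $sat_{\circlearrowright}(n,C)=\Theta(n)$.
   Context: A cyclically ordered graph is a finite simple graph whose vertex set is cyclically ordered. For vertices $u,x,v$ write $u<x<v$ if starting from $u$ and going clockwise one meets $x$ before $v$; the open interval $I_{u,v}$ is $\{x: u<x<v\}$. A cyclically ordered graph $H$ contains $C$ if there is an injective cyclic-order-preserving map $\varphi:V(C)\to V(H)$ with $\varphi(u)\varphi(v)\in E(H)$ for all $uv\in E(C)$; otherwise $H$ avoids $C$. $H$ saturates $C$ if $H$ avoids $C$ but adding any non-edge to $H$ yields a graph containing $C$. $sat_{\circlearrowright}(n,C)$ is the minimum number of edges of a cyclically ordered graph on $n$ vertices saturating $C$. An edge $uv$ of $C$ is a minedge if $I_{u,v}$ or $I_{v,u}$ is empty and both $u,v$ have degree one. An edge $uv$ of $C$ is a bisuperedge if both $I_{u,v}$ and $I_{v,u}$ contain both endpoints of some edge of $C$. $L_3$ is the cyclically ordered matching on vertex set $[6]$ (natural cyclic order) with edges $\{1,2\},\{3,4\},\{5,6\}$. -}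

module Defs where

open import Data.Nat using (ℕ; zero; suc; _+_; _*_; _<_; _<ᵇ_)
open import Data.Fin using (Fin; toℕ) renaming (zero to fz; suc to fs)
open import Data.Fin.Patterns using (0F; 1F; 2F; 3F; 4F; 5F)
open import Data.Bool using (Bool; true; false; if_then_else_; _∧_; _∨_)
open import Data.List using (List; map; allFin)
open import Data.Nat.ListAction using (sum)
open import Data.Product using (Σ; _×_; ∃; ∃-syntax; _,_)
open import Data.Sum using (_⊎_)
open import Relation.Binary.PropositionalEquality using (_≡_; _≢_)
open import Relation.Nullary using (¬_)
open import Function.Definitions using (Injective)
open import Data.Fin using (_≟_)
open import Relation.Nullary.Decidable using (⌊_⌋)

-- A cyclically ordered graph on n vertices.  Every finite cyclically
-- ordered set is order-isomorphic to Fin n with the natural cyclic order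
-- 0 → 1 → … → n-1 → 0, so vertices are Fin n with that order.
record COGraph (n : ℕ) : Set where
  field
    edge   : Fin n → Fin n → Bool
    esym   : ∀ u v → edge u v ≡ edge v u
    eirr   : ∀ u → edge u u ≡ false
open COGraph public

Adj : ∀ {n} → COGraph n → Fin n → Fin n → Set
Adj G u v = edge G u v ≡ true

-- Cyclic betweenness: u < x < v (clockwise from u one meets x before v).
Between : ∀ {n} → Fin n → Fin n → Fin n → Set
Between u x v =
  (toℕ u < toℕ x × toℕ x < toℕ v) ⊎
  (toℕ x < toℕ v × toℕ v < toℕ u) ⊎
  (toℕ v < toℕ u × toℕ u < toℕ x)

InInterval : ∀ {n} → Fin n → Fin n → Fin n → Set
InInterval u v x = Between u x v

Contains : ∀ {k n} → COGraph n → COGraph k → Set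
Contains {k} {n} H C =
  Σ (Fin k → Fin n) λ φ →
    Injective _≡_ _≡_ φ ×
    (∀ u x v → Between u x v → Between (φ u) (φ x) (φ v)) ×
    (∀ u v → Adj C u v → Adj H (φ u) (φ v))

Avoids : ∀ {k n} → COGraph n → COGraph k → Set
Avoids H C = ¬ Contains H C

addEdge : ∀ {n} → COGraph n → Fin n → Fin n → COGraph n
addEdge {n} G a b = record
  { edge = e
  ; esym = symm
  ; eirr = irr
  }
  where
  isab : Fin n → Fin n → Bool
  isab u v = (⌊ u ≟ a ⌋ ∧ ⌊ v ≟ b ⌋) ∨ (⌊ u ≟ b ⌋ ∧ ⌊ v ≟ a ⌋)
  e : Fin n → Fin n → Bool
  e u v = if ⌊ u ≟ v ⌋ then false else (edge G u v ∨ isab u v)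
  open import Data.Bool.Properties using (∨-comm)
  open import Relation.Binary.PropositionalEquality using (refl; cong₂; sym)
  open import Relation.Nullary using (yes; no)
  symm : ∀ u v → e u v ≡ e v u
  symm u v with u ≟ v | v ≟ u
  ... | yes _ | yes _ = refl
  ... | yes p | no q = Data.Empty.⊥-elim (q (sym p)) where import Data.Empty
  ... | no p | yes q = Data.Empty.⊥-elim (p (sym q)) where import Data.Empty
  ... | no _ | no _ = cong₂ _∨_ (esym G u v) (Relation.Binary.PropositionalEquality.trans (∨-comm (⌊ u ≟ a ⌋ ∧ ⌊ v ≟ b ⌋) (⌊ u ≟ b ⌋ ∧ ⌊ v ≟ a ⌋)) lem)
    where
    open import Data.Bool.Properties using (∧-comm)
    lem : (⌊ u ≟ b ⌋ ∧ ⌊ v ≟ a ⌋) ∨ (⌊ u ≟ a ⌋ ∧ ⌊ v ≟ b ⌋) ≡ (⌊ v ≟ a ⌋ ∧ ⌊ u ≟ b ⌋) ∨ (⌊ v ≟ b ⌋ ∧ ⌊ u ≟ a ⌋)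
    lem = cong₂ _∨_ (∧-comm ⌊ u ≟ b ⌋ ⌊ v ≟ a ⌋) (∧-comm ⌊ u ≟ a ⌋ ⌊ v ≟ b ⌋)
  irr : ∀ u → e u u ≡ false
  irr u with u ≟ u
  ... | yes _ = refl
  ... | no p = Data.Empty.⊥-elim (p refl) where import Data.Empty

Saturates : ∀ {k n} → COGraph n → COGraph k → Set
Saturates H C =
  Avoids H C ×
  (∀ u v → u ≢ v → edge H u v ≡ false → Contains (addEdge H u v) C)

countB : ∀ {n} → (Fin n → Bool) → ℕ
countB {n} p = sum (map (λ x → if p x then 1 else 0) (allFin n))

numEdges : ∀ {n} → COGraph n → ℕ
numEdges {n} G = sum (map (λ u → countB (λ v → (toℕ u <ᵇ toℕ v) ∧ edge G u v)) (allFin n))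

degree : ∀ {n} → COGraph n → Fin n → ℕ
degree G u = countB (λ v → edge G u v)

IsSat : ∀ {k} → ℕ → COGraph k → ℕ → Set
IsSat n C m =
  (Σ (COGraph n) λ H → Saturates H C × numEdges H ≡ m) ×
  (∀ (H : COGraph n) → Saturates H C → m Data.Nat.≤ numEdges H)
  where import Data.Nat

IntervalEmpty : ∀ {k} → Fin k → Fin k → Set
IntervalEmpty u v = ∀ x → ¬ InInterval u v x

Minedge : ∀ {k} → COGraph k → Fin k → Fin k → Set
Minedge C u v =
  Adj C u v ×
  (IntervalEmpty u v ⊎ IntervalEmpty v u) ×
  degree C u ≡ 1 × degree C v ≡ 1

Bisuperedge : ∀ {k} → COGraph k → Fin k → Fin k → Set
Bisuperedge C u v =
  Adj C u v ×
  (∃[ a ] ∃[ b ] Adj C a b × InInterval u v a × InInterval u v b) ×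
  (∃[ a ] ∃[ b ] Adj C a b × InInterval v u a × InInterval v u b)

L3edge : Fin 6 → Fin 6 → Bool
L3edge 0F 1F = true
L3edge 1F 0F = true
L3edge 2F 3F = true
L3edge 3F 2F = true
L3edge 4F 5F = true
L3edge 5F 4F = true
L3edge _ _ = false

L₃ : COGraph 6
L₃ = record { edge = L3edge ; esym = s ; eirr = i }
  where
  open import Relation.Binary.PropositionalEquality using (refl)
  s : ∀ u v → L3edge u v ≡ L3edge v u
  s 0F 0F = refl
  s 0F 1F = refl
  s 0F 2F = refl
  s 0F 3F = refl
  s 0F 4F = refl
  s 0F 5F = refl
  s 1F 0F = refl
  s 1F 1F = refl
  s 1F 2F = refl
  s 1F 3F = refl
  s 1F 4F = refl
  s 1F 5F = refl
  s 2F 0F = refl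
  s 2F 1F = refl
  s 2F 2F = refl
  s 2F 3F = refl
  s 2F 4F = refl
  s 2F 5F = refl
  s 3F 0F = refl
  s 3F 1F = refl
  s 3F 2F = refl
  s 3F 3F = refl
  s 3F 4F = refl
  s 3F 5F = refl
  s 4F 0F = refl
  s 4F 1F = refl
  s 4F 2F = refl
  s 4F 3F = refl
  s 4F 4F = refl
  s 4F 5F = refl
  s 5F 0F = refl
  s 5F 1F = refl
  s 5F 2F = refl
  s 5F 3F = refl
  s 5F 4F = refl
  s 5F 5F = refl
  i : ∀ u → L3edge u u ≡ false
  i 0F = refl
  i 1F = refl
  i 2F = refl
  i 3F = refl
  i 4F = refl
  i 5F = refl

{-# OPTIONS --safe #-}
-- Lower bound: a saturated H has no isolated vertex.  If u were isolated, let w be the first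
-- vertex clockwise from u that ends an edge aw with u < a < w, and add uw.  The resulting copy of C
-- uses uw in the role of some edge pq.  No edge of H lies inside (u , w), so pq is not a bisuperedge;
-- and if pq is a minedge then aw can play its role, so H already contains C.
-- Upper bound: the first edge of C to end is a minedge xx′ with x′ = x + 1.  Spread C − xx′ over n
-- vertices with the whole slack between x and x′, and complete greedily.  Any edge with both ends in
-- that gap would restore xx′, so every edge meets one of the fewer than k vertices outside the gap.
module Submission where

open import Defs
open import Data.Bool using (Bool; true; false; if_then_else_; _∧_; _∨_)
open import Data.Bool.Properties using (∨-zeroʳ)
open import Data.Empty using (⊥; ⊥-elim)
open import Data.Fin using (Fin; toℕ; fromℕ<; _≟_; punchOut; combine; remQuot; funToFin; finToFun) renaming (zero to fz; suc to fs)
open import Data.Fin.Induction using (<-wellFounded; spo-wellFounded)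
open import Data.Fin.Patterns using (0F; 1F; 2F; 3F)
open import Data.Fin.Properties using (any?; all?; toℕ-injective; toℕ<n; toℕ-fromℕ<; injective⇒≤; punchOut-injective; finToFun-funToFin; remQuot-combine)
open import Data.Fin.Subset using (Subset)
open import Data.Fin.Subset.Properties using (anySubset?)
open import Data.List using (List; []; _∷_; map; allFin; cartesianProduct)
open import Data.List.Membership.Propositional using (_∈_)
open import Data.List.Membership.Propositional.Properties using (∈-allFin; ∈-cartesianProduct⁺)
open import Data.List.Properties using (map-cong; map-tabulate)
open import Data.List.Relation.Unary.All using (All; []; _∷_) renaming (lookup to lookupAll)
open import Data.List.Relation.Unary.Any using (here; there)
open import Data.Nat using (ℕ; zero; suc; _+_; _*_; _≤_; _<_; _<ᵇ_; z≤n; s≤s; NonZero; _<?_)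
open import Data.Nat.Induction using () renaming (<-wellFounded to <ᴺ-wellFounded)
open import Data.Nat.ListAction using (sum)
open import Data.Nat.Properties hiding (_≟_; _<?_)
open import Algebra.Properties.CommutativeMonoid.Sum +-0-commutativeMonoid using (∑-comm; ∑-distrib-+) renaming (sum to sumᶠ)
open import Data.Product using (Σ; _×_; ∃; ∃-syntax; _,_; proj₁; proj₂; uncurry)
open import Data.Sum using (_⊎_; inj₁; inj₂)
open import Data.Vec using (lookup; tabulate)
open import Data.Vec.Properties using (lookup∘tabulate)
open import Function using (_∘_; id; flip)
open import Function.Definitions using (Injective)
open import Induction.WellFounded using (WellFounded; Acc; acc)
open import Relation.Binary.Definitions using (tri<; tri≈; tri>)
open import Relation.Binary.PropositionalEquality using (_≡_; _≢_; refl; sym; trans; cong; cong₂; subst; subst₂; isEquivalence; module ≡-Reasoning)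
open import Relation.Nullary using (¬_; Dec; yes; no; contradiction)
open import Relation.Nullary.Decidable using (⌊_⌋; map′; _×-dec_; _⊎-dec_; _→-dec_; ¬?)
open import Relation.Unary using (Decidable)
import Data.Bool as Bool
import Data.Nat as ℕ

-- Decidability and descent to minimal elements

⌊⌋⁺ : ∀ {P : Set} (P? : Dec P) → P → ⌊ P? ⌋ ≡ true
⌊⌋⁺ (yes _) _ = refl
⌊⌋⁺ (no ¬p) p = contradiction p ¬p

⌊⌋⁻ : ∀ {P : Set} (P? : Dec P) → ⌊ P? ⌋ ≡ true → P
⌊⌋⁻ (yes p) _ = p

⌊⌋-cong : ∀ {P Q : Set} (P? : Dec P) (Q? : Dec Q) → (P → Q) → (Q → P) → ⌊ P? ⌋ ≡ ⌊ Q? ⌋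
⌊⌋-cong (yes _) (yes _) _ _ = refl
⌊⌋-cong (yes p) (no ¬q) f _ = contradiction (f p) ¬q
⌊⌋-cong (no ¬p) (yes q) _ g = contradiction (g q) ¬p
⌊⌋-cong (no _)  (no _)  _ _ = refl

∨⁻ : ∀ x {y} → x ∨ y ≡ true → x ≡ true ⊎ y ≡ true
∨⁻ true  _ = inj₁ refl
∨⁻ false e = inj₂ e

∧⁻ : ∀ x {y} → x ∧ y ≡ true → x ≡ true × y ≡ true
∧⁻ true e = refl , e

true≢false : ∀ {b} → b ≡ true → b ≢ false
true≢false refl ()

-- `below?` decides whether a smaller witness exists, so well-founded descent stops at a minimal one
-- without excluded middle.
minimal : ∀ {A : Set} {_⊏_ : A → A → Set} {P : A → Set} → WellFounded _⊏_ →
          (∀ x → Dec (∃[ y ] (y ⊏ x × P y))) → ∀ {x} → P x →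
          ∃[ m ] (P m × (∀ y → y ⊏ m → ¬ P y))
minimal {_⊏_ = _⊏_} {P} wf below? {x} = go (wf x)
  where
  go : ∀ {x} → Acc _⊏_ x → P x → ∃[ m ] (P m × (∀ y → y ⊏ m → ¬ P y))
  go {x} (acc rs) px with below? x
  ... | yes (y , y⊏x , py) = go (rs y⊏x) py
  ... | no none            = x , px , λ y y⊏x py → none (y , y⊏x , py)

-- Cyclic betweenness

-- Between u x v unfolds to Cyclic (toℕ u) (toℕ x) (toℕ v); on ℕ the implicit arguments can be inferred.
Cyclic : ℕ → ℕ → ℕ → Set
Cyclic a b c = (a < b × b < c) ⊎ (b < c × c < a) ⊎ (c < a × a < b)

cyc-rot : ∀ {a b c} → Cyclic a b c → Cyclic b c a
cyc-rot (inj₁ p)        = inj₂ (inj₂ p)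
cyc-rot (inj₂ (inj₁ p)) = inj₁ p
cyc-rot (inj₂ (inj₂ p)) = inj₂ (inj₁ p)

-- This is transitivity of the linear order obtained by cutting the circle at `a`.
cyc-trans : ∀ {a b c d} → Cyclic a b c → Cyclic a c d → Cyclic a b d
cyc-trans (inj₁ (ab , bc))        (inj₁ (_ , cd))         = inj₁ (ab , <-trans bc cd)
cyc-trans (inj₁ (ab , bc))        (inj₂ (inj₁ (cd , da))) = ⊥-elim (<-asym (<-trans ab bc) (<-trans cd da))
cyc-trans (inj₁ (ab , _))         (inj₂ (inj₂ (da , _)))  = inj₂ (inj₂ (da , ab))
cyc-trans (inj₂ (inj₁ (_ , ca)))  (inj₁ (ac , _))         = ⊥-elim (<-asym ca ac)
cyc-trans (inj₂ (inj₁ (bc , _)))  (inj₂ (inj₁ (cd , da))) = inj₂ (inj₁ (<-trans bc cd , da))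
cyc-trans (inj₂ (inj₁ (_ , ca)))  (inj₂ (inj₂ (_ , ac)))  = ⊥-elim (<-asym ca ac)
cyc-trans (inj₂ (inj₂ (ca , _)))  (inj₁ (ac , _))         = ⊥-elim (<-asym ca ac)
cyc-trans (inj₂ (inj₂ (_ , ab)))  (inj₂ (inj₁ (_ , da)))  = inj₂ (inj₂ (da , ab))
cyc-trans (inj₂ (inj₂ (ca , _)))  (inj₂ (inj₂ (_ , ac)))  = ⊥-elim (<-asym ca ac)

cyc-transʳ : ∀ {a b c d} → Cyclic a b c → Cyclic a c d → Cyclic b c d
cyc-transʳ abc acd = cyc-rot (cyc-rot (cyc-trans (cyc-rot acd) (cyc-rot (cyc-rot abc))))

cyc-≢ : ∀ {a b c} → Cyclic a b c → a ≢ b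
cyc-≢ (inj₁ (ab , _))         refl = <-irrefl refl ab
cyc-≢ (inj₂ (inj₁ (bc , ca))) refl = <-asym bc ca
cyc-≢ (inj₂ (inj₂ (_ , ab)))  refl = <-irrefl refl ab

cyc-total : ∀ {a b c} → a ≢ b → b ≢ c → a ≢ c → Cyclic a b c ⊎ Cyclic a c b
cyc-total {a} {b} {c} a≢b b≢c a≢c with <-cmp a b | <-cmp b c | <-cmp a c
... | tri≈ _ e _  | _           | _           = contradiction e a≢b
... | _           | tri≈ _ e _  | _           = contradiction e b≢c
... | _           | _           | tri≈ _ e _  = contradiction e a≢c
... | tri< ab _ _ | tri< bc _ _ | _           = inj₁ (inj₁ (ab , bc))
... | tri< ab _ _ | tri> _ _ cb | tri< ac _ _ = inj₂ (inj₁ (ac , cb))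
... | tri< ab _ _ | tri> _ _ cb | tri> _ _ ca = inj₁ (inj₂ (inj₂ (ca , ab)))
... | tri> _ _ ba | tri< bc _ _ | tri< ac _ _ = inj₂ (inj₂ (inj₂ (ba , ac)))
... | tri> _ _ ba | tri< bc _ _ | tri> _ _ ca = inj₁ (inj₂ (inj₁ (bc , ca)))
... | tri> _ _ ba | tri> _ _ cb | _           = inj₂ (inj₂ (inj₁ (cb , ba)))

between? : ∀ {n} (u x v : Fin n) → Dec (Between u x v)
between? u x v = ((toℕ u <? toℕ x) ×-dec (toℕ x <? toℕ v)) ⊎-dec
                 (((toℕ x <? toℕ v) ×-dec (toℕ v <? toℕ u)) ⊎-dec
                  ((toℕ v <? toℕ u) ×-dec (toℕ u <? toℕ x)))

between-total : ∀ {n} {u x v : Fin n} → u ≢ x → x ≢ v → u ≢ v → Between u x v ⊎ Between u v x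
between-total u≢x x≢v u≢v = cyc-total (u≢x ∘ toℕ-injective) (x≢v ∘ toℕ-injective) (u≢v ∘ toℕ-injective)

-- A strict order on a finite set is well founded. The lower bound uses it to pick a first vertex
-- clockwise from `u`.
clockwise-wellFounded : ∀ {n} (u : Fin n) → WellFounded (λ x v → Between u x v)
clockwise-wellFounded u = spo-wellFounded record
  { isEquivalence = isEquivalence
  ; irrefl        = λ { refl b → cyc-≢ (cyc-rot b) refl }
  ; trans         = cyc-trans
  ; <-resp-≈      = (λ { refl b → b }) , (λ { refl b → b })
  }

mono⇒between : ∀ {k n} (φ : Fin k → Fin n) → (∀ i j → toℕ i < toℕ j → toℕ (φ i) < toℕ (φ j)) →
               ∀ u x v → Between u x v → Between (φ u) (φ x) (φ v)
mono⇒between φ mono u x v (inj₁ (p , q))        = inj₁ (mono _ _ p , mono _ _ q)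
mono⇒between φ mono u x v (inj₂ (inj₁ (p , q))) = inj₂ (inj₁ (mono _ _ p , mono _ _ q))
mono⇒between φ mono u x v (inj₂ (inj₂ (p , q))) = inj₂ (inj₂ (mono _ _ p , mono _ _ q))

mono⇒injective : ∀ {k} (f : Fin k → ℕ) → (∀ i j → toℕ i < toℕ j → f i < f j) → Injective _≡_ _≡_ f
mono⇒injective f mono {i} {j} e with <-cmp (toℕ i) (toℕ j)
... | tri< i<j _ _ = ⊥-elim (<-irrefl e (mono i j i<j))
... | tri≈ _ i≡j _ = toℕ-injective i≡j
... | tri> _ _ j<i = ⊥-elim (<-irrefl (sym e) (mono j i j<i))

-- Subgraphs and edge addition

adj? : ∀ {n} (G : COGraph n) u v → Dec (Adj G u v)
adj? G u v = edge G u v Bool.≟ true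

adj-sym : ∀ {n} (G : COGraph n) {u v} → Adj G u v → Adj G v u
adj-sym G {u} {v} uv = trans (esym G v u) uv

adj-≢ : ∀ {n} (G : COGraph n) {u v} → Adj G u v → u ≢ v
adj-≢ G {u} uv refl = true≢false uv (eirr G u)

infix 4 _⊆ᴳ_

_⊆ᴳ_ : ∀ {n} → COGraph n → COGraph n → Set
G ⊆ᴳ H = ∀ u v → Adj G u v → Adj H u v

module _ {n} (G : COGraph n) (a b : Fin n) where

  addEdge⁻ : ∀ u v → Adj (addEdge G a b) u v → Adj G u v ⊎ (u ≡ a × v ≡ b) ⊎ (u ≡ b × v ≡ a)
  addEdge⁻ u v uv with u ≟ v
  ... | no _ with ∨⁻ (edge G u v) uv
  ...   | inj₁ old = inj₁ old
  ...   | inj₂ new with ∨⁻ (⌊ u ≟ a ⌋ ∧ ⌊ v ≟ b ⌋) new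
  ...     | inj₁ ab with ∧⁻ ⌊ u ≟ a ⌋ ab
  ...       | p , q = inj₂ (inj₁ (⌊⌋⁻ (u ≟ a) p , ⌊⌋⁻ (v ≟ b) q))
  addEdge⁻ u v uv | no _ | inj₂ new | inj₂ ba with ∧⁻ ⌊ u ≟ b ⌋ ba
  ...       | p , q = inj₂ (inj₂ (⌊⌋⁻ (u ≟ b) p , ⌊⌋⁻ (v ≟ a) q))

  addEdge-⊆ : G ⊆ᴳ addEdge G a b
  addEdge-⊆ u v uv with u ≟ v
  ... | yes refl = contradiction refl (adj-≢ G uv)
  ... | no _ rewrite uv = refl

  addEdge-new : a ≢ b → Adj (addEdge G a b) a b
  addEdge-new a≢b with a ≟ b
  ... | yes a≡b = contradiction a≡b a≢b
  ... | no _ rewrite ⌊⌋⁺ (a ≟ a) refl | ⌊⌋⁺ (b ≟ b) refl = ∨-zeroʳ _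

  -- Nothing is asked of `H` when `a ≡ b`, because `addEdge` adds no loop.
  addEdge-⊆-least : ∀ H → G ⊆ᴳ H → (a ≢ b → Adj H a b) → addEdge G a b ⊆ᴳ H
  addEdge-⊆-least H G⊆H ab u v uv with addEdge⁻ u v uv
  ... | inj₁ old                  = G⊆H u v old
  ... | inj₂ (inj₁ (refl , refl)) = ab (adj-≢ (addEdge G a b) uv)
  ... | inj₂ (inj₂ (refl , refl)) = adj-sym H (ab (adj-≢ (addEdge G a b) uv ∘ sym))

⊆-antisym : ∀ {n} (G H : COGraph n) → G ⊆ᴳ H → H ⊆ᴳ G → ∀ u v → edge G u v ≡ edge H u v
⊆-antisym G H G⊆H H⊆G u v with edge G u v in p | edge H u v in q
... | true  | true  = refl
... | true  | false = contradiction q (true≢false (G⊆H u v p))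
... | false | true  = contradiction p (true≢false (H⊆G u v q))
... | false | false = refl

addEdge-mono : ∀ {n} (G H : COGraph n) a b → G ⊆ᴳ H → addEdge G a b ⊆ᴳ addEdge H a b
addEdge-mono G H a b G⊆H =
  addEdge-⊆-least G a b (addEdge H a b) (λ u v → addEdge-⊆ H a b u v ∘ G⊆H u v) (addEdge-new H a b)

contains-mono : ∀ {k n} (C : COGraph k) (G H : COGraph n) → G ⊆ᴳ H → Contains G C → Contains H C
contains-mono C G H G⊆H (φ , inj , ord , hom) = φ , inj , ord , λ u v → G⊆H _ _ ∘ hom u v

module FromRelation {n} (R : Fin n → Fin n → Set) (R? : ∀ u v → Dec (R u v))
                    (R-sym : ∀ {u v} → R u v → R v u) (R-irr : ∀ {u} → ¬ R u u) where

  graph : COGraph n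
  graph = record
    { edge = λ u v → ⌊ R? u v ⌋
    ; esym = λ u v → ⌊⌋-cong (R? u v) (R? v u) R-sym R-sym
    ; eirr = λ u → ⌊⌋-cong (R? u u) (no λ (x : ⊥) → x) R-irr ⊥-elim
    }

  graph⁺ : ∀ {u v} → R u v → Adj graph u v
  graph⁺ {u} {v} = ⌊⌋⁺ (R? u v)

  graph⁻ : ∀ {u v} → Adj graph u v → R u v
  graph⁻ {u} {v} = ⌊⌋⁻ (R? u v)

-- Sums over Fin n

⟦_⟧ : Bool → ℕ
⟦ b ⟧ = if b then 1 else 0

∑ : ∀ {n} → (Fin n → ℕ) → ℕ
∑ {n} f = sum (map f (allFin n))

∑-suc : ∀ {n} (f : Fin (suc n) → ℕ) → ∑ f ≡ f fz + ∑ (f ∘ fs)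
∑-suc {n} f = cong (λ xs → f fz + sum xs) (trans (map-tabulate fs f) (sym (map-tabulate id (f ∘ fs))))

∑≡sumᶠ : ∀ {n} (f : Fin n → ℕ) → ∑ f ≡ sumᶠ f
∑≡sumᶠ {zero}  f = refl
∑≡sumᶠ {suc n} f = trans (∑-suc f) (cong (f fz +_) (∑≡sumᶠ (f ∘ fs)))

∑-cong : ∀ {n} (f g : Fin n → ℕ) → (∀ i → f i ≡ g i) → ∑ f ≡ ∑ g
∑-cong {n} f g e = cong sum (map-cong e (allFin n))

∑-mono : ∀ {n} (f g : Fin n → ℕ) → (∀ i → f i ≤ g i) → ∑ f ≤ ∑ g
∑-mono {zero}  f g le = z≤n
∑-mono {suc n} f g le = subst₂ _≤_ (sym (∑-suc f)) (sym (∑-suc g))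
                          (+-mono-≤ (le fz) (∑-mono (f ∘ fs) (g ∘ fs) (le ∘ fs)))

∑-+ : ∀ {n} (f g : Fin n → ℕ) → ∑ (λ i → f i + g i) ≡ ∑ f + ∑ g
∑-+ f g = trans (∑≡sumᶠ (λ i → f i + g i)) (trans (∑-distrib-+ f g)
            (sym (cong₂ _+_ (∑≡sumᶠ f) (∑≡sumᶠ g))))

∑-swap : ∀ {m n} (f : Fin m → Fin n → ℕ) → ∑ (λ i → ∑ (f i)) ≡ ∑ (λ j → ∑ (λ i → f i j))
∑-swap f = begin
  ∑ (λ i → ∑ (f i))                ≡⟨ ∑-cong _ (sumᶠ ∘ f) (λ i → ∑≡sumᶠ (f i)) ⟩
  ∑ (sumᶠ ∘ f)                     ≡⟨ ∑≡sumᶠ (sumᶠ ∘ f) ⟩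
  sumᶠ (sumᶠ ∘ f)                  ≡⟨ ∑-comm f ⟩
  sumᶠ (sumᶠ ∘ flip f)             ≡⟨ ∑≡sumᶠ (sumᶠ ∘ flip f) ⟨
  ∑ (sumᶠ ∘ flip f)                ≡⟨ ∑-cong _ (sumᶠ ∘ flip f) (λ j → ∑≡sumᶠ (flip f j)) ⟨
  ∑ (λ j → ∑ (flip f j))           ∎
  where open ≡-Reasoning

∑-const : ∀ n c → ∑ {n} (λ _ → c) ≡ n * c
∑-const zero    c = refl
∑-const (suc n) c = trans (∑-suc {n} (λ _ → c)) (cong (c +_) (∑-const n c))

-- Indices are peeled off the front: `s` terms bounded by 1, then the `d` zero terms of the window,
-- then `t` terms bounded by 1.
∑-≤-outside : ∀ s d t {n} → n ≡ s + (d + t) → (f : Fin n → ℕ) → (∀ i → f i ≤ 1) →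
              (∀ i → s ≤ toℕ i → toℕ i < s + d → f i ≡ 0) → ∑ f ≤ s + t
∑-≤-outside zero zero t refl f f≤1 _ = begin
  ∑ f              ≤⟨ ∑-mono f (λ _ → 1) f≤1 ⟩
  ∑ {t} (λ _ → 1)  ≡⟨ trans (∑-const t 1) (*-identityʳ t) ⟩
  t                ∎
  where open ≤-Reasoning
∑-≤-outside zero (suc d) t refl f f≤1 gap = begin
  ∑ f                ≡⟨ ∑-suc f ⟩
  f fz + ∑ (f ∘ fs)  ≡⟨ cong (_+ ∑ (f ∘ fs)) (gap fz z≤n (s≤s z≤n)) ⟩
  ∑ (f ∘ fs)         ≤⟨ ∑-≤-outside zero d t refl (f ∘ fs) (f≤1 ∘ fs) (λ i _ i<d → gap (fs i) z≤n (s≤s i<d)) ⟩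
  t                  ∎
  where open ≤-Reasoning
∑-≤-outside (suc s) d t refl f f≤1 gap = begin
  ∑ f                ≡⟨ ∑-suc f ⟩
  f fz + ∑ (f ∘ fs)  ≤⟨ +-mono-≤ (f≤1 fz) (∑-≤-outside s d t refl (f ∘ fs) (f≤1 ∘ fs)
                          (λ i s≤i i<d → gap (fs i) (s≤s s≤i) (s≤s i<d))) ⟩
  suc (s + t)        ∎
  where open ≤-Reasoning

-- Mutual inclusion stands in for equality of graphs: without function extensionality, equal edges
-- do not give equal records.
numEdges-resp : ∀ {n} (G H : COGraph n) → G ⊆ᴳ H → H ⊆ᴳ G → numEdges G ≡ numEdges H
numEdges-resp G H G⊆H H⊆G = ∑-cong (λ u → ∑ (entry G u)) (λ u → ∑ (entry H u)) λ u →
  ∑-cong (entry G u) (entry H u) λ v →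
    cong (λ b → ⟦ (toℕ u <ᵇ toℕ v) ∧ b ⟧) (⊆-antisym G H G⊆H H⊆G u v)
  where
  entry : ∀ {n} → COGraph n → Fin n → Fin n → ℕ
  entry G u v = ⟦ (toℕ u <ᵇ toℕ v) ∧ edge G u v ⟧

-- Finite search

module _ {k n} (H : COGraph n) (C : COGraph k) where

  IsEmbedding : (Fin k → Fin n) → Set
  IsEmbedding φ = (∀ i j → φ i ≡ φ j → i ≡ j) ×
                  (∀ u x v → Between u x v → Between (φ u) (φ x) (φ v)) ×
                  (∀ u v → Adj C u v → Adj H (φ u) (φ v))

  isEmbedding? : Decidable IsEmbedding
  isEmbedding? φ =
    all? (λ i → all? λ j → (φ i ≟ φ j) →-dec (i ≟ j)) ×-dec
    (all? (λ u → all? λ x → all? λ v → between? u x v →-dec between? (φ u) (φ x) (φ v)) ×-dec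
     all? (λ u → all? λ v → adj? C u v →-dec adj? H (φ u) (φ v)))

  -- `finToFun` recovers a coded map only pointwise, so the search over codes needs a predicate that
  -- respects pointwise equality.
  isEmbedding-resp : ∀ {φ ψ} → (∀ i → φ i ≡ ψ i) → IsEmbedding φ → IsEmbedding ψ
  isEmbedding-resp {φ} {ψ} e (inj , ord , hom) =
    (λ i j ij → inj i j (trans (e i) (trans ij (sym (e j))))) ,
    (λ u x v b → resp₃ (ord u x v b)) ,
    (λ u v uv → subst₂ (Adj H) (e u) (e v) (hom u v uv))
    where
    resp₃ : ∀ {u x v} → Between (φ u) (φ x) (φ v) → Between (ψ u) (ψ x) (ψ v)
    resp₃ {u} {x} {v} b rewrite e u | e x | e v = b

  contains? : Dec (Contains H C)
  contains? = map′ (λ (i , inj , ord , hom) → finToFun i , inj _ _ , ord , hom)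
                   (λ (φ , inj , ord , hom) → funToFin φ ,
                      isEmbedding-resp (sym ∘ finToFun-funToFin φ) ((λ _ _ → inj) , ord , hom))
                   (any? (isEmbedding? ∘ finToFun))

module _ {n : ℕ} where

  -- A subset of `n * n` is read as an adjacency matrix. Asking for both entries and `u ≢ v` makes
  -- every subset decode to a simple graph, so a search over subsets is a search over graphs.
  Pairs : Subset (n * n) → Fin n → Fin n → Set
  Pairs s u v = u ≢ v × lookup s (combine u v) ≡ true × lookup s (combine v u) ≡ true

  pairs? : ∀ s u v → Dec (Pairs s u v)
  pairs? s u v = ¬? (u ≟ v) ×-dec
                 ((lookup s (combine u v) Bool.≟ true) ×-dec (lookup s (combine v u) Bool.≟ true))

  module Decode (s : Subset (n * n)) = FromRelation (Pairs s) (pairs? s)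
    (λ (u≢v , p , q) → u≢v ∘ sym , q , p) (λ (u≢u , _) → u≢u refl)

  decode : Subset (n * n) → COGraph n
  decode s = Decode.graph s

  encode : COGraph n → Subset (n * n)
  encode G = tabulate (uncurry (edge G) ∘ remQuot n)

  lookup-encode : ∀ G u v → lookup (encode G) (combine u v) ≡ edge G u v
  lookup-encode G u v = trans (lookup∘tabulate _ (combine u v)) (cong (uncurry (edge G)) (remQuot-combine u v))

  decode-encode-⊇ : ∀ G → G ⊆ᴳ decode (encode G)
  decode-encode-⊇ G u v uv = Decode.graph⁺ (encode G)
    (adj-≢ G uv , trans (lookup-encode G u v) uv , trans (lookup-encode G v u) (adj-sym G uv))

  decode-encode-⊆ : ∀ G → decode (encode G) ⊆ᴳ G
  decode-encode-⊆ G u v uv = trans (sym (lookup-encode G u v)) (proj₁ (proj₂ (Decode.graph⁻ (encode G) uv)))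

anyGraph? : ∀ {n} {P : COGraph n → Set} → (∀ G H → G ⊆ᴳ H → H ⊆ᴳ G → P G → P H) →
            Decidable P → Dec (∃ P)
anyGraph? resp P? = map′ (λ (s , p) → decode s , p)
  (λ (G , p) → encode G , resp G (decode (encode G)) (decode-encode-⊇ G) (decode-encode-⊆ G) p)
  (anySubset? (P? ∘ decode))

module _ {k n : ℕ} (C : COGraph k) where

  saturates? : (H : COGraph n) → Dec (Saturates H C)
  saturates? H = ¬? (contains? H C) ×-dec
    all? (λ u → all? λ v → ¬? (u ≟ v) →-dec ((edge H u v Bool.≟ false) →-dec contains? (addEdge H u v) C))

  saturates-resp : (G H : COGraph n) → G ⊆ᴳ H → H ⊆ᴳ G → Saturates G C → Saturates H C
  saturates-resp G H G⊆H H⊆G (av , sat) =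
    av ∘ contains-mono C H G H⊆G ,
    λ u v u≢v e → contains-mono C (addEdge G u v) (addEdge H u v) (addEdge-mono G H u v G⊆H)
                    (sat u v u≢v (trans (⊆-antisym G H G⊆H H⊆G u v) e))

-- One greedy pass over all pairs suffices: a pair whose addition creates `C` still does so after
-- further insertions, because containment is monotone.
extend-saturated : ∀ {k n} (C : COGraph k) (G : COGraph n) → Avoids G C →
                   Σ (COGraph n) λ H → G ⊆ᴳ H × Saturates H C
extend-saturated {n = n} C G avoids with extend (cartesianProduct (allFin n) (allFin n)) G avoids
  where
  extend : (ps : List (Fin n × Fin n)) (G : COGraph n) → Avoids G C →
           Σ (COGraph n) λ H → G ⊆ᴳ H × Avoids H C ×
             All (λ (u , v) → u ≢ v → edge H u v ≡ false → Contains (addEdge H u v) C) ps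
  extend [] G av = G , (λ _ _ → id) , av , []
  extend ((u , v) ∷ ps) G av with contains? (addEdge G u v) C
  ... | yes c = let H , G⊆H , avH , all = extend ps G av in
    H , G⊆H , avH ,
    (λ _ _ → contains-mono C (addEdge G u v) (addEdge H u v) (addEdge-mono G H u v G⊆H) c) ∷ all
  ... | no ¬c = let H , G′⊆H , avH , all = extend ps (addEdge G u v) ¬c in
    H , (λ a b → G′⊆H a b ∘ addEdge-⊆ G u v a b) , avH ,
    -- This pair has been inserted, so it cannot be a non-edge of `H`.
    (λ u≢v uv → contradiction uv (true≢false (G′⊆H u v (addEdge-new G u v u≢v)))) ∷ all
... | H , G⊆H , avH , all = H , G⊆H , avH ,
      λ u v → lookupAll all (∈-cartesianProduct⁺ {xs = allFin n} {ys = allFin n} (∈-allFin u) (∈-allFin v))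

-- Degrees and disjoint edges

count-pos : ∀ {A : Set} (p : A → Bool) {v} {xs : List A} → p v ≡ true → v ∈ xs →
            1 ≤ sum (map (⟦_⟧ ∘ p) xs)
count-pos p pv (here refl) rewrite pv = s≤s z≤n
count-pos p pv (there {x = x} v∈) = ≤-trans (count-pos p pv v∈) (m≤n+m _ ⟦ p x ⟧)

count-two : ∀ {A : Set} (p : A → Bool) {v w} {xs : List A} → p v ≡ true → p w ≡ true → v ≢ w →
            v ∈ xs → w ∈ xs → 2 ≤ sum (map (⟦_⟧ ∘ p) xs)
count-two p pv pw v≢w (here refl) (here refl) = contradiction refl v≢w
count-two p pv pw v≢w (here refl) (there w∈) rewrite pv = s≤s (count-pos p pw w∈)
count-two p pv pw v≢w (there v∈) (here refl) rewrite pw = s≤s (count-pos p pv v∈)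
count-two p pv pw v≢w (there {x = x} v∈) (there w∈) =
  ≤-trans (count-two p pv pw v≢w v∈ w∈) (m≤n+m _ ⟦ p x ⟧)

degree-one⇒unique : ∀ {n} (G : COGraph n) {u v w} → degree G u ≡ 1 → Adj G u v → Adj G u w → v ≡ w
degree-one⇒unique {n} G {u} {v} {w} deg uv uw with v ≟ w
... | yes v≡w = v≡w
... | no v≢w  = contradiction
  (count-two (edge G u) {xs = allFin n} uv uw v≢w (∈-allFin v) (∈-allFin w))
  (λ two → <-irrefl refl (subst (2 ≤_) deg two))

-- Prevents all edges of `C` from sharing a vertex, the degenerate case that arises in both bounds.
record DisjointEdges {k} (C : COGraph k) : Set where
  field
    {a b c d} : Fin k
    ab        : Adj C a b
    cd        : Adj C c d
    a≢c       : a ≢ c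
    a≢d       : a ≢ d
    b≢c       : b ≢ c
    b≢d       : b ≢ d

L₃⇒disjointEdges : ∀ {k} (C : COGraph k) → Contains C L₃ → DisjointEdges C
L₃⇒disjointEdges C (φ , inj , _ , hom) = record
  { ab = hom 0F 1F refl ; cd = hom 2F 3F refl
  ; a≢c = λ e → 0≢2 (inj e) ; a≢d = λ e → 0≢3 (inj e) ; b≢c = λ e → 1≢2 (inj e) ; b≢d = λ e → 1≢3 (inj e) }
  where
  0≢2 : 0F ≢ 2F
  0≢2 ()
  0≢3 : 0F ≢ 3F
  0≢3 ()
  1≢2 : 1F ≢ 2F
  1≢2 ()
  1≢3 : 1F ≢ 3F
  1≢3 ()

-- Each of the two disjoint edges would have an end sent to `t`, against injectivity. The map `f` is
-- an embedding into `H` in one use and `id` in the others.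
not-star : ∀ {k} {X : Set} {C : COGraph k} → DisjointEdges C → {f : Fin k → X} → Injective _≡_ _≡_ f →
           ∀ t → ¬ (∀ p q → Adj C p q → f p ≡ t ⊎ f q ≡ t)
not-star E inj t star with star _ _ (DisjointEdges.ab E) | star _ _ (DisjointEdges.cd E)
... | inj₁ x | inj₁ y = DisjointEdges.a≢c E (inj (trans x (sym y)))
... | inj₁ x | inj₂ y = DisjointEdges.a≢d E (inj (trans x (sym y)))
... | inj₂ x | inj₁ y = DisjointEdges.b≢c E (inj (trans x (sym y)))
... | inj₂ x | inj₂ y = DisjointEdges.b≢d E (inj (trans x (sym y)))

-- The lower bound

module Isolated {k n} (C : COGraph k) (H : COGraph n) (E : DisjointEdges C)
                (min⊎bisuper : ∀ u v → Adj C u v → Minedge C u v ⊎ Bisuperedge C u v)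
                (avoids : Avoids H C)
                (saturated : ∀ u v → u ≢ v → edge H u v ≡ false → Contains (addEdge H u v) C)
                (u : Fin n) (isolated : ∀ v → ¬ Adj H u v) where

  isolated-≡false : ∀ v → edge H u v ≡ false
  isolated-≡false v with edge H u v in e
  ... | true  = contradiction e (isolated v)
  ... | false = refl

  -- If `H` had no edge, `uv` would be the only edge after the addition, and every edge of the copy
  -- would meet `u`.
  some-edge : ∀ v → u ≢ v → ∃[ p ] ∃[ q ] Adj H p q
  some-edge v u≢v with any? (λ p → any? (adj? H p)) | saturated u v u≢v (isolated-≡false v)
  ... | yes found | _ = found
  ... | no none | φ , inj , _ , hom = ⊥-elim (not-star E inj u λ p q pq → touches (addEdge⁻ H u v _ _ (hom p q pq)))
    where
    touches : ∀ {x y} → Adj H x y ⊎ (x ≡ u × y ≡ v) ⊎ (x ≡ v × y ≡ u) → x ≡ u ⊎ y ≡ u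
    touches (inj₁ xy)             = contradiction (_ , _ , xy) none
    touches (inj₂ (inj₁ (x , _))) = inj₁ x
    touches (inj₂ (inj₂ (_ , y))) = inj₂ y

  EndsEdge : Fin n → Set
  EndsEdge w = ∃[ a ] (Between u a w × Adj H a w)

  endsEdge? : Decidable EndsEdge
  endsEdge? w = any? λ a → between? u a w ×-dec adj? H a w

  not-isolated : ∀ {p q} → Adj H p q → u ≢ p
  not-isolated pq refl = isolated _ pq

  some-endsEdge : ∀ v → u ≢ v → ∃ EndsEdge
  some-endsEdge v u≢v with some-edge v u≢v
  ... | p , q , pq with between-total (not-isolated pq) (adj-≢ H pq) (not-isolated (adj-sym H pq))
  ...   | inj₁ upq = q , p , upq , pq
  ...   | inj₂ uqp = p , q , uqp , adj-sym H pq

  module First {w a} (uaw : Between u a w) (aw : Adj H a w)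
               (first : ∀ x → Between u x w → ¬ EndsEdge x) where

    u≢w : u ≢ w
    u≢w refl = cyc-≢ (cyc-rot (cyc-rot uaw)) refl

    -- Of the two ends, the one met later clockwise from `u` would end an edge before `w`, against
    -- the choice of `w`.
    no-edge-inside : ∀ {x y} → Between u x w → Between u y w → ¬ Adj H x y
    no-edge-inside {x} {y} uxw uyw xy
      with between-total (not-isolated xy) (adj-≢ H xy) (not-isolated (adj-sym H xy))
    ... | inj₁ uxy = first y uyw (x , uxy , xy)
    ... | inj₂ uyx = first x uxw (y , uyx , adj-sym H xy)

    module Copy (φ : Fin k → Fin n) (inj : Injective _≡_ _≡_ φ)
                (ord : ∀ i x j → Between i x j → Between (φ i) (φ x) (φ j))
                (hom : ∀ i j → Adj C i j → Adj (addEdge H u w) (φ i) (φ j))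
                {p q : Fin k} (pq : Adj C p q) (φp≡u : φ p ≡ u) (φq≡w : φ q ≡ w) where

      avoiding-u⇒old : ∀ {i j} → Adj C i j → φ i ≢ u → φ j ≢ u → Adj H (φ i) (φ j)
      avoiding-u⇒old ij i≢ j≢ with addEdge⁻ H u w _ _ (hom _ _ ij)
      ... | inj₁ old            = old
      ... | inj₂ (inj₁ (e , _)) = contradiction e i≢
      ... | inj₂ (inj₂ (_ , e)) = contradiction e j≢

      inside : ∀ {i} → Between p i q → Between u (φ i) w
      inside {i} piq = subst₂ (λ x y → Between x (φ i) y) φp≡u φq≡w (ord p i q piq)

      p≢q : p ≢ q
      p≢q = adj-≢ C pq

      no-edge-in-pq : ∀ {i j} → Adj C i j → Between p i q → ¬ Between p j q
      no-edge-in-pq ij piq pjq = no-edge-inside (inside piq) (inside pjq)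
        (avoiding-u⇒old ij (λ e → cyc-≢ (inside piq) (cong toℕ (sym e)))
                           (λ e → cyc-≢ (inside pjq) (cong toℕ (sym e))))

      -- No vertex of the copy lies strictly between `u` and `w`, so `p` can move from `u` to `a`
      -- without passing another vertex. Its only edge `pq` then lands on `aw`, an edge of `H`.
      module Reroute (empty : IntervalEmpty p q) (only-q : ∀ {i} → Adj C p i → q ≡ i) where

        after-a : ∀ {i} → i ≢ p → Between u a (φ i)
        after-a {i} i≢p with i ≟ q
        ... | yes refl = subst (Between u a) (sym φq≡w) uaw
        ... | no i≢q with between-total (i≢p ∘ sym) i≢q p≢q
        ...   | inj₁ piq = contradiction piq (empty i)
        ...   | inj₂ pqi = cyc-trans uaw (subst₂ (λ x y → Between x y (φ i)) φp≡u φq≡w (ord p q i pqi))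

        ψ : Fin k → Fin n
        ψ i with i ≟ p
        ... | yes _ = a
        ... | no _  = φ i

        ψ-p : ψ p ≡ a
        ψ-p with p ≟ p
        ... | yes _  = refl
        ... | no p≢p = contradiction refl p≢p

        ψ-≢p : ∀ {i} → i ≢ p → ψ i ≡ φ i
        ψ-≢p {i} i≢p with i ≟ p
        ... | yes i≡p = contradiction i≡p i≢p
        ... | no _    = refl

        a≢φ : ∀ {i} → i ≢ p → a ≢ φ i
        a≢φ i≢p e = cyc-≢ (cyc-rot (after-a i≢p)) (cong toℕ e)

        ψ-inj : Injective _≡_ _≡_ ψ
        ψ-inj {i} {j} e with i ≟ p | j ≟ p
        ... | yes i≡p | yes j≡p = trans i≡p (sym j≡p)
        ... | yes _   | no j≢p  = contradiction e (a≢φ j≢p)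
        ... | no i≢p  | yes _   = contradiction (sym e) (a≢φ i≢p)
        ... | no _    | no _    = inj e

        -- Clockwise from `u` come `a`, `φ x`, `φ j` in this order, so `a` may replace `u`. `ψ-ord`
        -- rotates every triple containing `p` to this form.
        ψ-ord-p : ∀ {x j} → Between p x j → Between (ψ p) (ψ x) (ψ j)
        ψ-ord-p {x} {j} pxj = subst (λ y → Between y (ψ x) (ψ j)) (sym ψ-p)
          (subst₂ (Between a) (sym (ψ-≢p x≢p)) (sym (ψ-≢p j≢p))
            (cyc-transʳ (after-a x≢p) (subst (λ y → Between y (φ x) (φ j)) φp≡u (ord p x j pxj))))
          where
          x≢p : x ≢ p
          x≢p refl = cyc-≢ pxj refl
          j≢p : j ≢ p
          j≢p refl = cyc-≢ (cyc-rot (cyc-rot pxj)) refl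

        ψ-ord : ∀ i x j → Between i x j → Between (ψ i) (ψ x) (ψ j)
        ψ-ord i x j ixj = go (i ≟ p) (x ≟ p) (j ≟ p)
          where
          go : Dec (i ≡ p) → Dec (x ≡ p) → Dec (j ≡ p) → Between (ψ i) (ψ x) (ψ j)
          go (yes refl) _          _          = ψ-ord-p ixj
          go (no _)     (yes refl) _          = cyc-rot (cyc-rot (ψ-ord-p (cyc-rot ixj)))
          go (no _)     (no _)     (yes refl) = cyc-rot (ψ-ord-p (cyc-rot (cyc-rot ixj)))
          go (no i≢p)   (no x≢p)   (no j≢p)
            rewrite ψ-≢p i≢p | ψ-≢p x≢p | ψ-≢p j≢p = ord i x j ixj

        ψ-hom-p : ∀ {j} → Adj C p j → Adj H (ψ p) (ψ j)
        ψ-hom-p pj with only-q pj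
        ... | refl = subst₂ (Adj H) (sym ψ-p) (trans (sym φq≡w) (sym (ψ-≢p (p≢q ∘ sym)))) aw

        ψ-hom : ∀ i j → Adj C i j → Adj H (ψ i) (ψ j)
        ψ-hom i j ij = go (i ≟ p) (j ≟ p)
          where
          go : Dec (i ≡ p) → Dec (j ≡ p) → Adj H (ψ i) (ψ j)
          go (yes refl) _          = ψ-hom-p ij
          go (no _)     (yes refl) = adj-sym H (ψ-hom-p (adj-sym C ij))
          go (no i≢p)   (no j≢p)   = subst₂ (Adj H) (sym (ψ-≢p i≢p)) (sym (ψ-≢p j≢p))
            (avoiding-u⇒old ij (λ e → i≢p (inj (trans e (sym φp≡u)))) (λ e → j≢p (inj (trans e (sym φp≡u)))))

        contained : Contains H C
        contained = ψ , ψ-inj , ψ-ord , ψ-hom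

      -- All vertices other than `p` and `q` lie in the interval from `p` to `q`, which contains no
      -- edge. Since `p` and `q` have only each other as neighbours, every edge meets `p`.
      module Enclosing (empty : IntervalEmpty q p) (only-q : ∀ {i} → Adj C p i → q ≡ i)
                       (only-p : ∀ {i} → Adj C q i → p ≡ i) where

        outside⇒between : ∀ {i} → i ≢ p → i ≢ q → Between p i q
        outside⇒between {i} i≢p i≢q with between-total (i≢p ∘ sym) i≢q p≢q
        ... | inj₁ piq = piq
        ... | inj₂ pqi = contradiction (cyc-rot pqi) (empty i)

        star-at-p : ∀ i j → Adj C i j → i ≡ p ⊎ j ≡ p
        star-at-p i j ij with i ≟ p | j ≟ p | i ≟ q | j ≟ q
        ... | yes i≡p | _       | _        | _        = inj₁ i≡p
        ... | no _    | yes j≡p | _        | _        = inj₂ j≡p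
        ... | no _    | no _    | yes refl | _        = inj₂ (sym (only-p ij))
        ... | no _    | no _    | no _     | yes refl = inj₁ (sym (only-p (adj-sym C ij)))
        ... | no i≢p  | no j≢p  | no i≢q   | no j≢q   =
          contradiction (outside⇒between j≢p j≢q) (no-edge-in-pq ij (outside⇒between i≢p i≢q))

      impossible : ⊥
      impossible with min⊎bisuper p q pq
      ... | inj₂ (_ , (i , j , ij , piq , pjq) , _) = no-edge-in-pq ij piq pjq
      ... | inj₁ (_ , inj₁ empty , deg-p , _) =
        avoids (Reroute.contained empty (degree-one⇒unique C deg-p pq))
      ... | inj₁ (_ , inj₂ empty , deg-p , deg-q) =
        not-star E id p (Enclosing.star-at-p empty
          (degree-one⇒unique C deg-p pq) (degree-one⇒unique C deg-q (adj-sym C pq)))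

    impossible : ⊥
    impossible with saturated u w u≢w (isolated-≡false w)
    -- Searching one orientation suffices, as an edge sent to `(w , u)` is found reversed. If no
    -- edge uses `uw`, the copy already lies in `H`.
    ... | φ , inj , ord , hom with any? (λ p → any? λ q → adj? C p q ×-dec ((φ p ≟ u) ×-dec (φ q ≟ w)))
    ...   | yes (p , q , pq , φp≡u , φq≡w) = Copy.impossible φ inj ord hom pq φp≡u φq≡w
    ...   | no none = avoids (φ , inj , ord , λ i j ij → old ij (addEdge⁻ H u w _ _ (hom i j ij)))
      where
      old : ∀ {i j} → Adj C i j → Adj H (φ i) (φ j) ⊎ (φ i ≡ u × φ j ≡ w) ⊎ (φ i ≡ w × φ j ≡ u) →
            Adj H (φ i) (φ j)
      old ij (inj₁ e)              = e
      old ij (inj₂ (inj₁ (x , y))) = contradiction (_ , _ , ij , x , y) none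
      old ij (inj₂ (inj₂ (x , y))) = contradiction (_ , _ , adj-sym C ij , y , x) none

  impossible : ∀ v → u ≢ v → ⊥
  impossible v u≢v with minimal (clockwise-wellFounded u)
                          (λ x → any? λ y → between? u y x ×-dec endsEdge? y) (proj₂ (some-endsEdge v u≢v))
  ... | w , (a , uaw , aw) , first = First.impossible uaw aw first

∃-≢ : ∀ {n} → 2 ≤ n → (u : Fin n) → ∃[ v ] u ≢ v
∃-≢ (s≤s (s≤s _)) fz     = fs fz , λ ()
∃-≢ (s≤s (s≤s _)) (fs _) = fz , λ ()

-- Every degree is at least 1. Neighbours split into those above and those below, and swapping the
-- sums turns the second part into `numEdges` as well.
n≤2*numEdges : ∀ {n} (G : COGraph n) → (∀ u → ∃[ v ] Adj G u v) → n ≤ 2 * numEdges G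
n≤2*numEdges {n} G nbr = begin
  n                                              ≡⟨ trans (∑-const n 1) (*-identityʳ n) ⟨
  ∑ {n} (λ _ → 1)                                ≤⟨ ∑-mono (λ _ → 1) (degree G) (λ u →
                                                      count-pos (edge G u) (proj₂ (nbr u)) (∈-allFin (proj₁ (nbr u)))) ⟩
  ∑ (λ u → ∑ (λ v → ⟦ edge G u v ⟧))             ≤⟨ ∑-mono (degree G) (λ u → ∑ (λ v → above u v + below u v)) (λ u →
                                                      ∑-mono (λ v → ⟦ edge G u v ⟧) (λ v → above u v + below u v) (split u)) ⟩
  ∑ (λ u → ∑ (λ v → above u v + below u v))      ≡⟨ ∑-cong (λ u → ∑ (λ v → above u v + below u v))
                                                      (λ u → ∑ (above u) + ∑ (below u)) (λ u → ∑-+ (above u) (below u)) ⟩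
  ∑ (λ u → ∑ (above u) + ∑ (below u))            ≡⟨ ∑-+ (∑ ∘ above) (∑ ∘ below) ⟩
  numEdges G + ∑ (λ u → ∑ (below u))             ≡⟨ cong (numEdges G +_) (∑-swap below) ⟩
  numEdges G + numEdges G                        ≡⟨ cong (numEdges G +_) (+-identityʳ (numEdges G)) ⟨
  2 * numEdges G                                 ∎
  where
  open ≤-Reasoning
  above below : Fin n → Fin n → ℕ
  above u v = ⟦ (toℕ u <ᵇ toℕ v) ∧ edge G u v ⟧
  below u v = above v u

  <⇒<ᵇ≡true : ∀ {a b} → a < b → (a <ᵇ b) ≡ true
  <⇒<ᵇ≡true {a} {b} a<b with a <ᵇ b | <⇒<ᵇ a<b
  ... | true | _ = refl

  split : ∀ u v → ⟦ edge G u v ⟧ ≤ above u v + below u v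
  split u v with <-cmp (toℕ u) (toℕ v)
  ... | tri< u<v _ _ rewrite <⇒<ᵇ≡true u<v = m≤m+n _ _
  ... | tri> _ _ v<u rewrite <⇒<ᵇ≡true v<u =
    ≤-trans (≤-reflexive (cong ⟦_⟧ (esym G u v))) (m≤n+m _ (above u v))
  ... | tri≈ _ e _ with toℕ-injective e
  ...   | refl rewrite eirr G u = z≤n

no-isolated : ∀ {k n} (C : COGraph k) (H : COGraph n) → DisjointEdges C →
              (∀ u v → Adj C u v → Minedge C u v ⊎ Bisuperedge C u v) →
              Saturates H C → 2 ≤ n → ∀ u → ∃[ v ] Adj H u v
no-isolated C H E min⊎bisuper (avoids , saturated) 2≤n u with any? (adj? H u)
... | yes found = found
... | no none   = ⊥-elim (uncurry (Isolated.impossible C H E min⊎bisuper avoids saturated u (λ v uv → none (v , uv)))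
                                  (∃-≢ 2≤n u))

-- The upper bound

-- A minedge that does not wrap around 0, with degree one expressed as uniqueness of the neighbour.
record ConsecutiveMinedge {k} (C : COGraph k) : Set where
  field
    {x x′}      : Fin k
    xx′         : Adj C x x′
    consecutive : toℕ x′ ≡ suc (toℕ x)
    only-x′     : ∀ {i} → Adj C x i → x′ ≡ i
    only-x      : ∀ {i} → Adj C x′ i → x ≡ i

module _ {k} (C : COGraph k) (E : DisjointEdges C)
         (min⊎bisuper : ∀ u v → Adj C u v → Minedge C u v ⊎ Bisuperedge C u v) where

  private
    EndsAt : Fin k → Set
    EndsAt v = ∃[ u ] (toℕ u < toℕ v × Adj C u v)

    endsAt? : Decidable EndsAt
    endsAt? v = any? λ u → (toℕ u <? toℕ v) ×-dec adj? C u v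

    some-end : ∃ EndsAt
    some-end with <-cmp (toℕ (DisjointEdges.a E)) (toℕ (DisjointEdges.b E))
    ... | tri< a<b _ _ = _ , _ , a<b , DisjointEdges.ab E
    ... | tri≈ _ e _   = contradiction (toℕ-injective e) (adj-≢ C (DisjointEdges.ab E))
    ... | tri> _ _ b<a = _ , _ , b<a , adj-sym C (DisjointEdges.ab E)

    module FirstEnd {x x′ : Fin k} (x<x′ : toℕ x < toℕ x′) (xx′ : Adj C x x′)
                    (first : ∀ v → toℕ v < toℕ x′ → ¬ EndsAt v) where

      -- The larger of the two ends would end an edge before `x′` does.
      late : ∀ {i j} → Adj C i j → toℕ i < toℕ x′ → ¬ (toℕ j < toℕ x′)
      late {i} {j} ij i<x′ j<x′ with <-cmp (toℕ i) (toℕ j)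
      ... | tri< i<j _ _ = first j j<x′ (i , i<j , ij)
      ... | tri≈ _ e _   = adj-≢ C ij (toℕ-injective e)
      ... | tri> _ _ j<i = first i i<x′ (j , j<i , adj-sym C ij)

      between⇒< : ∀ {y} → Between x y x′ → toℕ y < toℕ x′
      between⇒< (inj₁ (_ , y<x′))           = y<x′
      between⇒< (inj₂ (inj₁ (y<x′ , _)))    = y<x′
      between⇒< (inj₂ (inj₂ (x′<x , _)))    = ⊥-elim (<-asym x<x′ x′<x)

      consecutive : IntervalEmpty x x′ → toℕ x′ ≡ suc (toℕ x)
      consecutive empty with m≤n⇒m<n∨m≡n x<x′
      ... | inj₂ e    = sym e
      ... | inj₁ 1+x< = contradiction
        (inj₁ (subst (toℕ x <_) (sym eq) (n<1+n _) , subst (_< toℕ x′) (sym eq) 1+x<))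
        (empty (fromℕ< 1+x<k))
        where
        1+x<k : suc (toℕ x) < k
        1+x<k = <-trans 1+x< (toℕ<n x′)
        eq : toℕ (fromℕ< 1+x<k) ≡ suc (toℕ x)
        eq = toℕ-fromℕ< 1+x<k

      -- An empty interval from `x′` round to `x` leaves no vertex above `x′`, and by `late` no edge
      -- lies wholly below it.
      star-at-x′ : IntervalEmpty x′ x → ∀ i j → Adj C i j → i ≡ x′ ⊎ j ≡ x′
      star-at-x′ empty i j ij with <-cmp (toℕ i) (toℕ x′) | <-cmp (toℕ j) (toℕ x′)
      ... | tri≈ _ e _    | _             = inj₁ (toℕ-injective e)
      ... | _             | tri≈ _ e _    = inj₂ (toℕ-injective e)
      ... | tri> _ _ x′<i | _             = contradiction (inj₂ (inj₂ (x<x′ , x′<i))) (empty i)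
      ... | _             | tri> _ _ x′<j = contradiction (inj₂ (inj₂ (x<x′ , x′<j))) (empty j)
      ... | tri< i<x′ _ _ | tri< j<x′ _ _ = contradiction j<x′ (late ij i<x′)

      minedge : ConsecutiveMinedge C
      minedge with min⊎bisuper x x′ xx′
      -- A bisuperedge would enclose an edge between `x` and `x′`, hence one with both ends below
      -- `x′`.
      ... | inj₂ (_ , (i , j , ij , xix′ , xjx′) , _) =
        contradiction (between⇒< {j} xjx′) (late ij (between⇒< {i} xix′))
      ... | inj₁ (_ , inj₁ empty , deg , deg′) = record
        { xx′         = xx′
        ; consecutive = consecutive empty
        ; only-x′     = degree-one⇒unique C deg xx′
        ; only-x      = degree-one⇒unique C deg′ (adj-sym C xx′)
        }
      ... | inj₁ (_ , inj₂ empty , _ , _) = ⊥-elim (not-star E id x′ (star-at-x′ empty))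

  consecutiveMinedge : ConsecutiveMinedge C
  consecutiveMinedge with minimal <-wellFounded
                            (λ v → any? λ w → (toℕ w <? toℕ v) ×-dec endsAt? w) (proj₂ some-end)
  ... | x′ , (x , x<x′ , xx′) , first = FirstEnd.minedge x<x′ xx′ first

-- Pigeonhole: `punchOut` at the missed `x` would inject `Fin (suc k)` into `Fin k`.
self-injection-hits : ∀ {k} (x : Fin k) (g : Fin k → Fin k) → Injective _≡_ _≡_ g → ¬ (∀ i → x ≢ g i)
self-injection-hits {suc k} x g inj miss =
  <-irrefl refl (injective⇒≤ {f = λ i → punchOut (miss i)} (inj ∘ punchOut-injective (miss _) (miss _)))

-- Opening a gap at two consecutive vertices

data Position (s p : ℕ) : Set where
  low  : p < s     → Position s p
  here : p ≡ s     → Position s p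
  next : p ≡ suc s → Position s p
  high : suc s < p → Position s p

position : ∀ s p → Position s p
position s p with <-cmp p s
... | tri< p<s _ _ = low p<s
... | tri≈ _ p≡s _ = here p≡s
... | tri> _ _ s<p with m≤n⇒m<n∨m≡n s<p
...   | inj₁ 1+s<p = high 1+s<p
...   | inj₂ 1+s≡p = next (sym 1+s≡p)

-- Moves s to u and suc s to v, keeping d extra places free between the vertices below and above.
spread : ∀ d u v {s p} → Position s p → ℕ
spread d u v {p = p} (low _)  = p
spread d u v         (here _) = u
spread d u v         (next _) = v
spread d u v {p = p} (high _) = p + d

-- The gap consists of the `d + 2` places from `s` on. The next place, `s + (2 + d)`, is reserved
-- for vertex `2 + s`, hence the bound on `v`.
module _ {d u v s} (s≤u : s ≤ u) (u<v : u < v) (v<end : v < s + (2 + d)) where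

  private
    v<high : ∀ {q} → suc s < q → v < q + d
    v<high {q} 1+s<q = <-≤-trans v<end (begin
      s + (2 + d)      ≡⟨ +-suc s (suc d) ⟩
      suc (s + suc d)  ≡⟨ cong suc (+-suc s d) ⟩
      2 + s + d        ≤⟨ +-monoˡ-≤ d 1+s<q ⟩
      q + d            ∎)
      where open ≤-Reasoning

  spread-mono : ∀ {p q} (P : Position s p) (Q : Position s q) → p < q → spread d u v P < spread d u v Q
  spread-mono (low _)     (low _)     p<q = p<q
  spread-mono (low p<s)   (here _)    _   = <-≤-trans p<s s≤u
  spread-mono (low p<s)   (next _)    _   = <-trans (<-≤-trans p<s s≤u) u<v
  spread-mono (low _)     (high _)    p<q = <-≤-trans p<q (m≤m+n _ d)
  spread-mono (here refl) (low q<s)   p<q = ⊥-elim (<-asym p<q q<s)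
  spread-mono (here refl) (here refl) p<q = ⊥-elim (<-irrefl refl p<q)
  spread-mono (here _)    (next _)    _   = u<v
  spread-mono (here _)    (high s<q)  _   = <-trans u<v (v<high s<q)
  spread-mono (next refl) (low q<s)   p<q = ⊥-elim (<-asym (<-trans (n<1+n s) p<q) q<s)
  spread-mono (next refl) (here refl) p<q = ⊥-elim (<-asym (n<1+n s) p<q)
  spread-mono (next refl) (next refl) p<q = ⊥-elim (<-irrefl refl p<q)
  spread-mono (next _)    (high s<q)  _   = v<high s<q
  spread-mono (high s<p)  (low q<s)   p<q = ⊥-elim (<-asym (<-trans (n<1+n s) (<-trans s<p p<q)) q<s)
  spread-mono (high s<p)  (here refl) p<q = ⊥-elim (<-asym (n<1+n s) (<-trans s<p p<q))
  spread-mono (high s<p)  (next refl) p<q = ⊥-elim (<-asym s<p p<q)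
  spread-mono (high _)    (high _)    p<q = +-monoˡ-< d p<q

module _ {d u v s : ℕ} where

  spread-here : (P : Position s s) → spread d u v P ≡ u
  spread-here (low s<s)  = ⊥-elim (<-irrefl refl s<s)
  spread-here (here _)   = refl
  spread-here (next s≡)  = ⊥-elim (<-irrefl s≡ (n<1+n s))
  spread-here (high s<s) = ⊥-elim (<-asym (n<1+n s) s<s)

  spread-next : (P : Position s (suc s)) → spread d u v P ≡ v
  spread-next (low s<s)  = ⊥-elim (<-asym (n<1+n s) s<s)
  spread-next (here ≡s)  = ⊥-elim (<-irrefl (sym ≡s) (n<1+n s))
  spread-next (next _)   = refl
  spread-next (high s<s) = ⊥-elim (<-irrefl refl s<s)

  -- Lets a placement with `s` and `suc s` elsewhere in the gap be compared with `base`: the other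
  -- vertices do not move.
  spread-elsewhere : ∀ u′ v′ {p} (P : Position s p) → p ≢ s → p ≢ suc s → spread d u v P ≡ spread d u′ v′ P
  spread-elsewhere _ _ (low _)  _   _    = refl
  spread-elsewhere _ _ (here e) p≢s _    = contradiction e p≢s
  spread-elsewhere _ _ (next e) _   p≢1+ = contradiction e p≢1+
  spread-elsewhere _ _ (high _) _   _    = refl

  spread-< : ∀ {k p} (P : Position s p) → p < k → u < k + d → v < k + d → spread d u v P < k + d
  spread-< (low _)  p<k _   _   = <-≤-trans p<k (m≤m+n _ d)
  spread-< (here _) _   u<n _   = u<n
  spread-< (next _) _   _   v<n = v<n
  spread-< (high _) p<k _   _   = +-monoˡ-< d p<k

-- The sparse graph with a gap, and its completions

module Gap {k} (C : COGraph k) (M : ConsecutiveMinedge C) (d : ℕ) where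

  open ConsecutiveMinedge M

  s n : ℕ
  s = toℕ x
  n = k + d

  -- x′ may sit anywhere in the gap: like x, it is isolated in the graph below.
  base : Fin k → ℕ
  base p = spread d s (suc s) (position s (toℕ p))

  base-injective : Injective _≡_ _≡_ base
  base-injective = mono⇒injective base λ p q →
    spread-mono ≤-refl (n<1+n s) (<-≤-trans (m<m+n (suc s) (s≤s z≤n)) (≤-reflexive (sym (+-suc s (suc d)))))
      (position s (toℕ p)) (position s (toℕ q))

  -- This is `C − xx′` transported along `base`: forbidding `x` as an end removes exactly the edge
  -- `xx′`, as `x` has no other neighbour.
  ImageEdge : Fin n → Fin n → Set
  ImageEdge u v = ∃[ p ] ∃[ q ] (base p ≡ toℕ u × base q ≡ toℕ v × Adj C p q × p ≢ x × q ≢ x)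

  imageEdge? : ∀ u v → Dec (ImageEdge u v)
  imageEdge? u v = any? λ p → any? λ q → (base p ℕ.≟ toℕ u) ×-dec ((base q ℕ.≟ toℕ v) ×-dec
                     (adj? C p q ×-dec (¬? (p ≟ x) ×-dec ¬? (q ≟ x))))

  imageEdge-sym : ∀ {u v} → ImageEdge u v → ImageEdge v u
  imageEdge-sym (p , q , bp , bq , pq , p≢x , q≢x) = q , p , bq , bp , adj-sym C pq , q≢x , p≢x

  imageEdge-irr : ∀ {u} → ¬ ImageEdge u u
  imageEdge-irr (_ , _ , bp , bq , pq , _) = adj-≢ C pq (base-injective (trans bp (sym bq)))

  open FromRelation ImageEdge imageEdge? imageEdge-sym imageEdge-irr public

  -- A copy would carry the non-isolated vertices of `C` injectively to those of `C − xx′`, among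
  -- which `x` is missing. Fixing the isolated vertices turns this into a self-injection of `Fin k`
  -- that misses `x`.
  avoids : Avoids graph C
  avoids (φ , inj , _ , hom) = self-injection-hits x (proj₁ ∘ rep) rep-inj (λ i → miss (proj₂ (rep i)))
    where
    -- A non-isolated vertex is sent to its preimage in the copy of C − xx′, an isolated one to itself.
    Rep : Fin k → Fin k → Set
    Rep i p = (base p ≡ toℕ (φ i) × p ≢ x × ∃ (Adj C p)) ⊎ (p ≡ i × ¬ ∃ (Adj C i))

    rep : ∀ i → ∃ (Rep i)
    rep i with any? (adj? C i)
    ... | no none = i , inj₂ (refl , none)
    ... | yes (j , ij) with graph⁻ (hom i j ij)
    ...   | p , q , bp , _ , pq , p≢x , _ = p , inj₁ (bp , p≢x , q , pq)

    rep-unique : ∀ {i j p} → Rep i p → Rep j p → i ≡ j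
    rep-unique (inj₁ (bi , _))      (inj₁ (bj , _))      = inj (toℕ-injective (trans (sym bi) bj))
    rep-unique (inj₁ (_ , _ , nbr)) (inj₂ (refl , none)) = contradiction nbr none
    rep-unique (inj₂ (refl , none)) (inj₁ (_ , _ , nbr)) = contradiction nbr none
    rep-unique (inj₂ (refl , _))    (inj₂ (refl , _))    = refl

    rep-inj : Injective _≡_ _≡_ (proj₁ ∘ rep)
    rep-inj {i} {j} e = rep-unique (subst (Rep i) e (proj₂ (rep i))) (proj₂ (rep j))

    miss : ∀ {i p} → Rep i p → x ≢ p
    miss (inj₁ (_ , p≢x , _))  refl = p≢x refl
    miss (inj₂ (refl , none)) refl = none (x′ , xx′)

  InGap : Fin n → Set
  InGap u = s ≤ toℕ u × toℕ u < s + (2 + d)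

  inGap? : Decidable InGap
  inGap? u = (s ≤? toℕ u) ×-dec (toℕ u <? s + (2 + d))

  -- With `x` at `u`, `x′` at `v` and the rest as in `base`, the order is kept because the gap holds
  -- no other vertex of the copy, and `uv` restores the missing edge.
  gap-edge⇒contains : ∀ (H : COGraph n) → graph ⊆ᴳ H → ∀ {u v} → InGap u → InGap v →
                      toℕ u < toℕ v → Adj H u v → Contains H C
  gap-edge⇒contains H G⊆H {u} {v} (s≤u , _) (_ , v<end) u<v uv =
    place , mono⇒injective (toℕ ∘ place) place-mono ∘ cong toℕ , mono⇒between place place-mono , hom
    where
    pos : ∀ p → Position s (toℕ p)
    pos p = position s (toℕ p)

    place : Fin k → Fin n
    place p = fromℕ< (spread-< {d} {toℕ u} {toℕ v} (pos p) (toℕ<n p) (toℕ<n u) (toℕ<n v))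

    toℕ-place : ∀ p → toℕ (place p) ≡ spread d (toℕ u) (toℕ v) (pos p)
    toℕ-place p = toℕ-fromℕ< (spread-< {d} {toℕ u} {toℕ v} (pos p) (toℕ<n p) (toℕ<n u) (toℕ<n v))

    place-mono : ∀ p q → toℕ p < toℕ q → toℕ (place p) < toℕ (place q)
    place-mono p q p<q = subst₂ _<_ (sym (toℕ-place p)) (sym (toℕ-place q))
                           (spread-mono s≤u u<v v<end (pos p) (pos q) p<q)

    place-x : place x ≡ u
    place-x = toℕ-injective (trans (toℕ-place x) (spread-here (pos x)))

    place-x′ : place x′ ≡ v
    place-x′ = toℕ-injective (trans (toℕ-place x′) (go consecutive (pos x′)))
      where
      -- `toℕ x′` is generalised to `p` so that its equation with `suc s` can be matched.
      go : ∀ {p} → p ≡ suc s → (P : Position s p) → spread d (toℕ u) (toℕ v) P ≡ toℕ v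
      go refl = spread-next

    place-base : ∀ {p} → p ≢ x → p ≢ x′ → base p ≡ toℕ (place p)
    place-base {p} p≢x p≢x′ = trans
      (spread-elsewhere _ _ (pos p) (p≢x ∘ toℕ-injective) (λ e → p≢x′ (toℕ-injective (trans e (sym consecutive)))))
      (sym (toℕ-place p))

    ≢x′ : ∀ {p q} → Adj C p q → q ≢ x → p ≢ x′
    ≢x′ pq q≢x refl = q≢x (sym (only-x pq))

    hom : ∀ p q → Adj C p q → Adj H (place p) (place q)
    hom p q pq with p ≟ x | q ≟ x
    ... | yes refl | _ with only-x′ pq
    ...   | refl = subst₂ (Adj H) (sym place-x) (sym place-x′) uv
    hom p q pq | no _ | yes refl with only-x′ (adj-sym C pq)
    ...   | refl = subst₂ (Adj H) (sym place-x′) (sym place-x) (adj-sym H uv)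
    hom p q pq | no p≢x | no q≢x = G⊆H _ _ (graph⁺
      (p , q , place-base p≢x (≢x′ pq q≢x) , place-base q≢x (≢x′ (adj-sym C pq) p≢x) , pq , p≢x , q≢x))

  -- Each edge has an end outside the gap, so a pair is charged `out u + out v`. With at most `k`
  -- vertices outside, the charges over all pairs sum to at most `2kn`.
  numEdges-≤ : ∀ (H : COGraph n) → graph ⊆ᴳ H → Avoids H C → numEdges H ≤ (k + k) * n
  numEdges-≤ H G⊆H avoidsH = begin
    numEdges H                             ≤⟨ ∑-mono (∑ ∘ entry) (∑ ∘ cover) (λ u → ∑-mono (entry u) (cover u) (entry≤cover u)) ⟩
    ∑ (λ u → ∑ (cover u))                  ≡⟨ ∑-cong (∑ ∘ cover) (λ u → ∑ {n} (λ _ → out u) + ∑ out)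
                                                (λ u → ∑-+ (λ _ → out u) out) ⟩
    ∑ (λ u → ∑ {n} (λ _ → out u) + ∑ out)  ≡⟨ ∑-+ (λ u → ∑ {n} (λ _ → out u)) (λ _ → ∑ out) ⟩
    ∑ (λ u → ∑ {n} (λ _ → out u)) + total  ≡⟨ cong (_+ total) (∑-swap {n} {n} (λ u _ → out u)) ⟩
    total + total                          ≡⟨ cong₂ _+_ (∑-const n (∑ out)) (∑-const n (∑ out)) ⟩
    n * ∑ out + n * ∑ out                  ≤⟨ +-mono-≤ (*-monoʳ-≤ n ∑out≤k) (*-monoʳ-≤ n ∑out≤k) ⟩
    n * k + n * k                          ≡⟨ *-distribˡ-+ n k k ⟨
    n * (k + k)                            ≡⟨ *-comm n (k + k) ⟩
    (k + k) * n                            ∎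
    where
    open ≤-Reasoning

    entry : Fin n → Fin n → ℕ
    entry u v = ⟦ (toℕ u <ᵇ toℕ v) ∧ edge H u v ⟧

    out : Fin n → ℕ
    out u = if ⌊ inGap? u ⌋ then 0 else 1

    cover : Fin n → Fin n → ℕ
    cover u v = out u + out v

    total : ℕ
    total = ∑ {n} (λ _ → ∑ out)

    entry≤1 : ∀ b → ⟦ b ⟧ ≤ 1
    entry≤1 true  = ≤-refl
    entry≤1 false = z≤n

    entry≤cover : ∀ u v → entry u v ≤ cover u v
    entry≤cover u v with inGap? u | inGap? v
    ... | no _   | _     = ≤-trans (entry≤1 _) (m≤m+n 1 _)
    ... | yes _  | no _  = entry≤1 _
    ... | yes gu | yes gv with toℕ u <ᵇ toℕ v in u<v | edge H u v in uv
    ...   | false | _     = z≤n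
    ...   | true  | false = z≤n
    ...   | true  | true  = contradiction
      (gap-edge⇒contains H G⊆H gu gv (<ᵇ⇒< _ _ (subst Bool.T (sym u<v) _)) uv) avoidsH

    out≤1 : ∀ u → out u ≤ 1
    out≤1 u with inGap? u
    ... | yes _ = z≤n
    ... | no _  = ≤-refl

    out-gap : ∀ u → s ≤ toℕ u → toℕ u < s + (2 + d) → out u ≡ 0
    out-gap u s≤u u<end rewrite ⌊⌋⁺ (inGap? u) (s≤u , u<end) = refl

    ∑out≤k : ∑ out ≤ k
    -- `t` counts the vertices of `C` beyond `x′`. Outside the gap there are `s` places before and
    -- `t` after it, two fewer than `k`.
    ∑out≤k with m≤n⇒∃[o]m+o≡n (subst (_< k) consecutive (toℕ<n x′))
    ... | t , eq = begin
      ∑ out  ≤⟨ ∑-≤-outside s (2 + d) t n≡ out out≤1 out-gap ⟩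
      s + t  ≤⟨ m≤n+m (s + t) 2 ⟩
      2 + s + t  ≡⟨ eq ⟩
      k      ∎
      where
      n≡ : n ≡ s + (2 + d + t)
      n≡ = begin-equality
        k + d            ≡⟨ cong (_+ d) eq ⟨
        2 + s + t + d    ≡⟨ cong (2 +_) (+-assoc s t d) ⟩
        2 + (s + (t + d))  ≡⟨ cong (λ r → 2 + (s + r)) (+-comm t d) ⟩
        2 + (s + (d + t))  ≡⟨ cong suc (+-suc s (d + t)) ⟨
        suc (s + (1 + (d + t)))  ≡⟨ +-suc s (1 + (d + t)) ⟨
        s + (2 + d + t)  ∎

-- Existence of the minimum and the final bounds

isSat-exists : ∀ {k n} (C : COGraph k) (H : COGraph n) → Saturates H C → ∃[ m ] IsSat n C m
isSat-exists {n = n} C H sat = go (minimal <ᴺ-wellFounded (anyUpTo? attained?) (H , sat , refl))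
  where
  Attained : ℕ → Set
  Attained m = Σ (COGraph n) λ G → Saturates G C × numEdges G ≡ m

  attained? : Decidable Attained
  -- Decided by searching all graphs on `n` vertices. Descent from the edge count of `H` then
  -- reaches the least attained one.
  attained? m = anyGraph?
    (λ G H G⊆H H⊆G (satG , e) → saturates-resp C G H G⊆H H⊆G satG , trans (sym (numEdges-resp G H G⊆H H⊆G)) e)
    (λ G → saturates? C G ×-dec (numEdges G ℕ.≟ m))

  go : ∃[ m ] (Attained m × (∀ l → l < m → ¬ Attained l)) → ∃[ m ] IsSat n C m
  go (m , attained , least) = m , attained , λ G satG → ≮⇒≥ (λ lt → least _ lt (G , satG , refl))

theorem7 : ∀ {k} (C : COGraph k) →
    Contains C L₃ →
    (∀ u v → Adj C u v → Minedge C u v ⊎ Bisuperedge C u v) →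
    ∃[ a ] ∃[ b ] ∃[ N ] (NonZero a × (∀ n → N ≤ n →
    ∃[ m ] (IsSat n C m × n ≤ a * m × m ≤ b * n)))
-- The factor 2 comes from the absence of isolated vertices, and `k + k` from charging edges to
-- vertices outside the gap. From `n = k` on, `C` fits.
theorem7 {k} C L₃⊆C min⊎bisuper = 2 , k + k , k , _ , bounds
  where
  E : DisjointEdges C
  E = L₃⇒disjointEdges C L₃⊆C

  M : ConsecutiveMinedge C
  M = consecutiveMinedge C E min⊎bisuper

  open ConsecutiveMinedge M

  2≤k : 2 ≤ k
  2≤k = ≤-trans (s≤s (s≤s z≤n)) (subst (_< k) consecutive (toℕ<n x′))

  bounds : ∀ n → k ≤ n → ∃[ m ] (IsSat n C m × n ≤ 2 * m × m ≤ (k + k) * n)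
  bounds n k≤n with m≤n⇒∃[o]m+o≡n k≤n
  -- The surplus `d` of `n` over `k` becomes the slack in the gap.
  ... | d , refl = minimum (extend-saturated C (Gap.graph C M d) (Gap.avoids C M d))
    where
    minimum : (Σ (COGraph (k + d)) λ H → Gap.graph C M d ⊆ᴳ H × Saturates H C) →
              ∃[ m ] (IsSat (k + d) C m × k + d ≤ 2 * m × m ≤ (k + k) * (k + d))
    minimum (H , G⊆H , satH) = within (isSat-exists C H satH)
      where
      within : ∃ (IsSat (k + d) C) → ∃[ m ] (IsSat (k + d) C m × k + d ≤ 2 * m × m ≤ (k + k) * (k + d))
      -- The lower bound is applied to the minimiser `H₀`. The upper bound comes from the greedy
      -- completion `H`, whose edge count `m` cannot exceed.
      within (m , isSat@((H₀ , sat₀ , e) , least)) =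
        m , isSat ,
        subst (λ l → k + d ≤ 2 * l) e
          (n≤2*numEdges H₀ (no-isolated C H₀ E min⊎bisuper sat₀ (≤-trans 2≤k k≤n))) ,
        ≤-trans (least H satH) (Gap.numEdges-≤ C M d H G⊆H (proj₁ satH))
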